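{- Let $l$ be a positive integer and let $n$ be a positive integer that is a multiple of $l+1$. Let $D_l(n)$ denote the maximum number of pairwise non-intersecting (positive) $l$-diagonals that can be placed in an $n\times n$ square array. Then $$D_l(n)=\frac{n^2-n(l-2)}{l+1}.$$
   Context: An $n$-array is an $n\times n$ square array of unit squares; its lattice points are the corners of the unit squares, i.e. the points $(x,y)$ with $x,y\in\{0,1,\dots,n\}$. Only positive diagonals (slope $+1$) are considered. A 1-diagonal is the diagonal of positive slope of a unit square, i.e. the segment from $(x,y)$ to $(x+1,y+1)$ with $0\le x,y\le n-1$. An $l$-diagonal is the straight segment made up of the 1-diagonals of $l$ consecutive unit squares in which adjacent squares share exactly one lattice point and the segment passes through these common lattice points; thus it is the segment from $(x,y)$ to $(x+l,y+l)$ with $0\le x,y\le n-l$, containing the $l+1$ lattice points $(x+i,y+i)$, $0\le i\le l$. Two 1-diagonals intersect if they share a common lattice point (including an endpoint) or belong to the same unit square. Two $l$-diagonals intersect if any of the 1-diagonals forming one intersects any of the 1-diagonals forming the other. -}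

module Defs where

open import Data.Nat using (ℕ; suc; _+_; _≤_)
open import Data.Fin using (Fin; toℕ)
open import Data.Product using (Σ; ∃; _×_; _,_)
open import Data.Sum using (_⊎_)
open import Relation.Binary.PropositionalEquality using (_≡_; _≢_)
open import Relation.Nullary using (¬_)
open import Relation.Unary using (Pred)
open import Level using (0ℓ)

Point : Set
Point = ℕ × ℕ

-- The unit square with corners (x , y) and (x + 1 , y + 1), given by its
-- lower-left corner.
UnitSquare : Set
UnitSquare = ℕ × ℕ

-- Only diagonals of slope +1 are considered, so a 1-diagonal is determined by
-- the unit square it crosses.
record OneDiagonal : Set where
  constructor diagonalOf
  field
    square : UnitSquare

open OneDiagonal public

-- p lies on the given 1-diagonal: it is one of its two endpoints.
_On_ : Point → OneDiagonal → Set
p On diagonalOf (x , y) = p ≡ (x , y) ⊎ p ≡ (suc x , suc y)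

Intersect₁ : OneDiagonal → OneDiagonal → Set
Intersect₁ d e = (∃ λ p → p On d × p On e) ⊎ square d ≡ square e

-- The l-diagonal of the n-array from (x , y) to (x + l , y + l).  The bounds
-- are x, y ≤ n - l, stated without truncated subtraction so that there is no
-- such diagonal when n < l.
record Diagonal (l n : ℕ) : Set where
  constructor diagonal
  field
    x y : ℕ
    x+l≤n : x + l ≤ n
    y+l≤n : y + l ≤ n

piece : ∀ {l n} → Diagonal l n → Fin l → OneDiagonal
piece d i = diagonalOf (Diagonal.x d + toℕ i , Diagonal.y d + toℕ i)

Intersect : ∀ {l n} → Diagonal l n → Diagonal l n → Set
Intersect {l} d e = Σ (Fin l) λ i → Σ (Fin l) λ j → Intersect₁ (piece d i) (piece e j)

-- For l ≥ 1 every l-diagonal intersects itself, so the k diagonals are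
-- automatically distinct.
Placeable : (l n : ℕ) → Pred ℕ 0ℓ
Placeable l n k =
  Σ (Fin k → Diagonal l n) λ d → ∀ i j → i ≢ j → ¬ Intersect (d i) (d j)

IsMaximum : ∀ {a} → Pred ℕ a → Pred ℕ a
IsMaximum P m = P m × (∀ k → P k → k ≤ m)

-- D is the number D_l(n).
IsD : (l n : ℕ) → Pred ℕ 0ℓ
IsD l n = IsMaximum (Placeable l n)

{-# OPTIONS --safe #-}
-- Two l-diagonals intersect exactly when they share a lattice point, so a
-- placement packs blocks of m = l + 1 consecutive points into the lines of
-- slope 1.  Sliding each diagonal down its line until its smaller start
-- coordinate is a multiple of m never identifies two disjoint diagonals, and
-- the slid positions are pairwise disjoint; hence D_l(n) is their number.  For
-- n = (p + 1) m, the slid positions (a m , y) with a m ≤ y ≤ p m + 1 and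
-- (x , a m) with a m < x ≤ p m + 1 fill a (p + 1) × (p m + 3) grid: the
-- positions on or above the main diagonal with smaller coordinate a m take
-- part of row a, and those below it with smaller coordinate (p - a) m take
-- the rest.
module Submission where

open import Data.Nat using (ℕ; suc; NonZero)
open import Data.Nat.Divisibility using (_∣_)
open import Data.Integer using (+_; _-_; _*_; _^_)
open import Data.Rational using (_/_)
open import Data.Product using (∃; _×_)
open import Relation.Binary.PropositionalEquality using (_≡_)
open import Defs

open import Data.Fin using (Fin; toℕ; fromℕ<; opposite; combine; remQuot)
import Data.Fin as Fin
open import Data.Fin.Properties
  using (toℕ<n; toℕ≤pred[n]; toℕ-injective; toℕ-fromℕ<; opposite-prop; opposite-involutive;
         combine-injective; combine-remQuot; injective⇒≤)
import Data.Integer as ℤ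
import Data.Integer.Properties as ℤ
open import Data.Integer.Tactic.RingSolver using (solve-∀)
open import Data.Nat using (zero; _+_; _∸_; _≤_; _<_; s≤s; pred; ≢-nonZero⁻¹)
import Data.Nat as ℕ
open import Data.Nat.Divisibility using (divides)
open import Data.Nat.DivMod using (_%_; m≡m%n+[m/n]*n; m%n<n; m%n≤m; m<n*o⇒m/o<n)
open import Data.Nat.Properties
import Data.Nat.Tactic.RingSolver as ℕ-Solver
open import Data.Product using (_,_; ∃₂; proj₁; proj₂; uncurry)
open import Data.Product.Properties using (,-injective)
open import Data.Rational.Properties using (fromℚᵘ-cong)
open import Data.Rational.Unnormalised using (mkℚᵘ; *≡*)
open import Data.Sum using (_⊎_; inj₁; inj₂)
open import Function using (_∘_)
open import Relation.Binary.PropositionalEquality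
  using (refl; sym; trans; cong; cong₂; subst; module ≡-Reasoning)
open import Relation.Nullary using (¬_; yes; no; contradiction)

open Diagonal

toℕ+opposite : ∀ {n} (i : Fin (suc n)) → toℕ i + toℕ (opposite i) ≡ n
toℕ+opposite {n} i = trans (cong (toℕ i ℕ.+_) (opposite-prop i)) (m+[n∸m]≡n (toℕ≤pred[n] i))

opposite-injective : ∀ {n} {i j : Fin n} → opposite i ≡ opposite j → i ≡ j
opposite-injective {i = i} {j} eq =
  trans (sym (opposite-involutive i)) (trans (cong opposite eq) (opposite-involutive j))

quotient-unique : ∀ {m i j} a b → i < m → j < m → a ℕ.* m + i ≡ b ℕ.* m + j → a ≡ b × i ≡ j
quotient-unique zero zero _ _ eq = refl , eq
quotient-unique {m} {i} {j} zero (suc b) i<m _ refl =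
  contradiction i<m (≤⇒≯ (≤-trans (m≤m+n m (b ℕ.* m)) (m≤m+n _ j)))
quotient-unique {m} {i} {j} (suc a) zero _ j<m refl =
  contradiction j<m (≤⇒≯ (≤-trans (m≤m+n m (a ℕ.* m)) (m≤m+n _ i)))
quotient-unique {m} (suc a) (suc b) i<m j<m eq
  with a≡b , i≡j ← quotient-unique a b i<m j<m
         (+-cancelˡ-≡ m _ _ (trans (sym (+-assoc m _ _)) (trans eq (+-assoc m _ _))))
  = cong suc a≡b , i≡j

-- Intersection as a common lattice point.

flip : ∀ {l n} → Diagonal l n → Diagonal l n
flip (diagonal x y x≤ y≤) = diagonal y x y≤ x≤

-- The offsets count the `suc l` lattice points rather than the `l` pieces, and are naturals, so
-- that remainders modulo `l + 1` can serve as offsets directly.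
Share : ∀ {l n} → Diagonal l n → Diagonal l n → Set
Share {l} d e = ∃₂ λ i j → i < suc l × j < suc l × x d + i ≡ x e + j × y d + i ≡ y e + j

share-sym : ∀ {l n} (d e : Diagonal l n) → Share d e → Share e d
share-sym _ _ (i , j , i≤l , j≤l , ex , ey) = j , i , j≤l , i≤l , sym ex , sym ey

share-flip : ∀ {l n} (d e : Diagonal l n) → Share (flip d) (flip e) → Share d e
share-flip _ _ (i , j , i≤l , j≤l , ex , ey) = i , j , i≤l , j≤l , ey , ex

-- A common point puts both diagonals on one line of slope 1, where `y - x` is constant.
share-≤ : ∀ {l n} (d e : Diagonal l n) → Share d e → x d ≤ y d → x e ≤ y e
share-≤ d e (i , j , _ , _ , ex , ey) x≤y =
  +-cancelʳ-≤ j _ _ (subst (_≤ y e + j) ex (subst (x d + i ≤_) ey (+-monoˡ-≤ i x≤y)))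

-- Point 0 is the lower end of the first piece, which exists because the length is `suc k`; point
-- `i + 1` is the upper end of piece `i`, which also reaches the last point.
point-on-piece : ∀ {k n} (d : Diagonal (suc k) n) {i} → i < suc (suc k) →
                 ∃ λ j → (x d + i , y d + i) On piece d j
point-on-piece d {zero} _ = Fin.zero , inj₁ refl
point-on-piece d {suc i} (s≤s i<l) =
  fromℕ< i<l , inj₂ (cong₂ _,_ (shift (x d)) (shift (y d)))
  where
  shift : ∀ u → u + suc i ≡ suc (u + toℕ (fromℕ< i<l))
  shift u = trans (+-suc u i) (cong (λ t → suc (u + t)) (sym (toℕ-fromℕ< i<l)))

on-piece⇒point : ∀ {l n} (d : Diagonal l n) (j : Fin l) {q} → q On piece d j →
                 ∃ λ i → i < suc l × q ≡ (x d + i , y d + i)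
on-piece⇒point d j (inj₁ eq) = toℕ j , m<n⇒m<1+n (toℕ<n j) , eq
on-piece⇒point d j (inj₂ eq) =
  suc (toℕ j) , s≤s (toℕ<n j) ,
  trans eq (sym (cong₂ _,_ (+-suc (x d) (toℕ j)) (+-suc (y d) (toℕ j))))

share⇒intersect : ∀ {k n} (d e : Diagonal (suc k) n) → Share d e → Intersect d e
share⇒intersect d e (i , j , i≤l , j≤l , ex , ey)
  with i′ , on-d ← point-on-piece d i≤l | j′ , on-e ← point-on-piece e j≤l
  = i′ , j′ , inj₁ (_ , on-d , subst (_On piece e j′) (sym (cong₂ _,_ ex ey)) on-e)

intersect⇒share : ∀ {l n} (d e : Diagonal l n) → Intersect d e → Share d e
intersect⇒share d e (i , j , inj₁ (q , on-d , on-e))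
  with i′ , i≤l , eq-d ← on-piece⇒point d i on-d
     | j′ , j≤l , eq-e ← on-piece⇒point e j on-e
  with ex , ey ← ,-injective (trans (sym eq-d) eq-e)
  = i′ , j′ , i≤l , j≤l , ex , ey
-- Equal unit squares have the same lower-left corner, which is a common endpoint.
intersect⇒share d e (i , j , inj₂ eq) =
  intersect⇒share d e (i , j , inj₁ (_ , inj₁ refl , inj₁ eq))

-- Slots and sliding.

module Packing (k p : ℕ) where

  l m n : ℕ
  l = suc k
  m = suc l
  n = suc p ℕ.* m

  Slot : Set
  Slot = Fin (suc p) × Fin (3 + p ℕ.* m)

  row col : Slot → ℕ
  row = toℕ ∘ proj₁
  col = toℕ ∘ proj₂

  -- The slid positions (a m , y), y ≥ a m, get the slots (a , y + 1).  The slots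
  -- with y > a m are carried by this half-turn exactly onto the unused ones,
  -- which therefore serve the reflected positions (y , a m).
  opp : Slot → Slot
  opp (a , b) = opposite a , opposite b

  opp-injective : ∀ {s t} → opp s ≡ opp t → s ≡ t
  opp-injective eq with ea , eb ← ,-injective eq =
    cong₂ _,_ (opposite-injective ea) (opposite-injective eb)

  -- Since `n = p * m + l + 1`, starts may go one past the last multiple `p * m` of `m`.
  start⇒fits : ∀ {u} → u ≤ suc (p ℕ.* m) → u + l ≤ n
  start⇒fits {u} u≤ = subst (u + l ≤_) (cong suc (+-comm (p ℕ.* m) l)) (+-monoˡ-≤ l u≤)

  fits⇒start : ∀ {u} → u + l ≤ n → u ≤ suc (p ℕ.* m)
  fits⇒start {u} u≤ =
    +-cancelʳ-≤ l _ _ (subst (u + l ≤_) (cong suc (+-comm l (p ℕ.* m))) u≤)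

  start/m< : ∀ {u} → u + l ≤ n → u ℕ./ m < suc p
  -- Here `l ≥ 1` enters: `m = k + 2 ≥ 2` gives `1 + p * m < suc p * m`.
  start/m< u≤ = m<n*o⇒m/o<n (s≤s (≤-trans (fits⇒start u≤) (s≤s (m≤n+m (p ℕ.* m) k))))

  start-slid< : ∀ {u v} → v + l ≤ n → v ∸ u % m < 2 + p ℕ.* m
  start-slid< {u} {v} v≤ = s≤s (≤-trans (m∸n≤m v (u % m)) (fits⇒start v≤))

  -- The truncated subtraction is a genuine slide when `x ≤ y`, which `encode` ensures by flipping
  -- the other diagonals.
  slot : Diagonal l n → Slot
  slot (diagonal x y x≤ y≤) =
    fromℕ< (start/m< {x} x≤) ,
    Fin.suc (fromℕ< (start-slid< {x} {y} y≤))

  row-slot : ∀ d → row (slot d) ≡ x d ℕ./ m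
  row-slot d = toℕ-fromℕ< (start/m< {x d} (x+l≤n d))

  col-slot : ∀ d → col (slot d) ≡ suc (y d ∸ x d % m)
  col-slot d = cong suc (toℕ-fromℕ< (start-slid< {x d} {y d} (y+l≤n d)))

  quotient+remainder : ∀ u → u ≡ u ℕ./ m ℕ.* m + u % m
  quotient+remainder u = trans (m≡m%n+[m/n]*n u m) (+-comm (u % m) _)

  -- Sliding preserves `y - x`. The slack `c` is 0 for diagonals on or above the main diagonal and 1
  -- for flipped ones, which lie strictly above.
  slot-above : ∀ d {c} → c + x d ≤ y d → c + row (slot d) ℕ.* m < col (slot d)
  slot-above d {c} x≤y rewrite row-slot d | col-slot d =
    s≤s (m+n≤o⇒m≤o∸n (c + x d ℕ./ m ℕ.* m) (begin
      c + x d ℕ./ m ℕ.* m + x d % m     ≡⟨ +-assoc c _ _ ⟩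
      c + (x d ℕ./ m ℕ.* m + x d % m)   ≡⟨ cong (c ℕ.+_) (quotient+remainder (x d)) ⟨
      c + x d                           ≤⟨ x≤y ⟩
      y d                               ∎))
    where open ≤-Reasoning

  slot-share : ∀ d e → x d ≤ y d → x e ≤ y e → slot d ≡ slot e → Share d e
  slot-share d e d≤ e≤ eq =
    -- The slid starts coincide, so each diagonal takes the other's remainder as offset: both reach
    -- the slid start plus the two remainders.
    x e % m , x d % m , m%n<n (x e) m , m%n<n (x d) m , ex , ey
    where
    rows : x d ℕ./ m ≡ x e ℕ./ m
    rows = trans (sym (row-slot d)) (trans (cong row eq) (row-slot e))

    cols : y d ∸ x d % m ≡ y e ∸ x e % m
    cols = suc-injective (trans (sym (col-slot d)) (trans (cong col eq) (col-slot e)))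

    cross : ∀ {u v} q r s → u ≡ q + r → v ≡ q + s → u + s ≡ v + r
    cross q r s refl refl = swap q r s
      where
      swap : ∀ q r s → q + r + s ≡ q + s + r
      swap = ℕ-Solver.solve-∀

    ex : x d + x e % m ≡ x e + x d % m
    ex = cross (x e ℕ./ m ℕ.* m) (x d % m) (x e % m)
      (trans (quotient+remainder (x d)) (cong (λ a → a ℕ.* m + x d % m) rows))
      (quotient+remainder (x e))

    ey : y d + x e % m ≡ y e + x d % m
    ey = cross (y e ∸ x e % m) (x d % m) (x e % m)
      (trans (sym (m∸n+n≡m (≤-trans (m%n≤m (x d) m) d≤))) (cong (ℕ._+ x d % m) cols))
      (sym (m∸n+n≡m (≤-trans (m%n≤m (x e) m) e≤)))

  -- The half-turn.

  row+opp : ∀ s → row s + row (opp s) ≡ p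
  row+opp (a , _) = toℕ+opposite a

  col+opp : ∀ s → col s + col (opp s) ≡ 2 + p ℕ.* m
  col+opp (_ , b) = toℕ+opposite b

  -- The integers `col - row * m` of a slot and of its half-turn image add up to 2. If one is at
  -- least 1, the other is at most 1; if one is at most 0, the other is at least 2, which gives the
  -- companion lemma.
  above⇒¬opp-above : ∀ s → row s ℕ.* m < col s → ¬ 1 + row (opp s) ℕ.* m < col (opp s)
  above⇒¬opp-above s above opp-above = <-irrefl refl (begin-strict
    2 + p ℕ.* m                                    ≡⟨ cong (λ r → 2 + r ℕ.* m) (row+opp s) ⟨
    2 + (row s + row (opp s)) ℕ.* m                <⟨ ≤-reflexive (regroup (row s) (row (opp s)) m) ⟩
    suc (row s ℕ.* m) + (2 + row (opp s) ℕ.* m)    ≤⟨ +-mono-≤ above opp-above ⟩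
    col s + col (opp s)                            ≡⟨ col+opp s ⟩
    2 + p ℕ.* m                                    ∎)
    where
    open ≤-Reasoning
    regroup : ∀ a b m → 3 + (a + b) ℕ.* m ≡ suc (a ℕ.* m) + (2 + b ℕ.* m)
    regroup = ℕ-Solver.solve-∀

  ¬above⇒opp-above : ∀ s → col s ≤ row s ℕ.* m → 1 + row (opp s) ℕ.* m < col (opp s)
  ¬above⇒opp-above s below = +-cancelˡ-≤ (row s ℕ.* m) _ _ (begin
    row s ℕ.* m + (2 + row (opp s) ℕ.* m)   ≡⟨ regroup (row s) (row (opp s)) m ⟩
    2 + (row s + row (opp s)) ℕ.* m         ≡⟨ cong (λ r → 2 + r ℕ.* m) (row+opp s) ⟩
    2 + p ℕ.* m                             ≡⟨ col+opp s ⟨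
    col s + col (opp s)                     ≤⟨ +-monoˡ-≤ _ below ⟩
    row s ℕ.* m + col (opp s)               ∎)
    where
    open ≤-Reasoning
    regroup : ∀ a b m → a ℕ.* m + (2 + b ℕ.* m) ≡ 2 + (a + b) ℕ.* m
    regroup = ℕ-Solver.solve-∀

  -- Upper bound: diagonals with equal codes meet.

  encode : (d : Diagonal l n) → x d ≤ y d ⊎ y d < x d → Slot
  encode d (inj₁ _) = slot d
  encode d (inj₂ _) = opp (slot (flip d))

  encode-share : ∀ d e side side′ → encode d side ≡ encode e side′ → Share d e
  encode-share d e (inj₁ d≤) (inj₁ e≤) eq = slot-share d e d≤ e≤ eq
  encode-share d e (inj₂ d>) (inj₂ e>) eq =
    share-flip d e (slot-share (flip d) (flip e) (<⇒≤ d>) (<⇒≤ e>) (opp-injective eq))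
  -- Opposite sides cannot collide: the half-turn of `slot d` would be the slot of a diagonal
  -- strictly above the main one.
  encode-share d e (inj₁ d≤) (inj₂ e>) eq = contradiction (slot-above (flip e) e>)
    λ above → above⇒¬opp-above (slot d) (slot-above d d≤)
      (subst (λ s → 1 + row s ℕ.* m < col s) (sym (opp-flip eq)) above)
    where
    opp-flip : slot d ≡ opp (slot (flip e)) → opp (slot d) ≡ slot (flip e)
    opp-flip eq = trans (cong opp eq) (cong₂ _,_ (opposite-involutive _) (opposite-involutive _))
  encode-share d e side@(inj₂ _) side′@(inj₁ _) eq =
    share-sym e d (encode-share e d side′ side (sym eq))

  orient : (d : Diagonal l n) → x d ≤ y d ⊎ y d < x d
  orient d = ≤-<-connex (x d) (y d)

  code : Diagonal l n → Slot
  code d = encode d (orient d)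

  -- Lower bound: one diagonal per slot.

  slotted : Slot → Diagonal l n
  -- `pred` undoes the column shift of `slot`. Its default value at column 0 never occurs in
  -- `decode`, where columns are positive.
  slotted (a , b) = diagonal (toℕ a ℕ.* m) (pred (toℕ b))
    (start⇒fits (m≤n⇒m≤1+n (*-monoˡ-≤ m (toℕ≤pred[n] a))))
    (start⇒fits (pred-mono-≤ (toℕ≤pred[n] b)))

  -- The `x`-starts are multiples of `m` and the offsets are below `m`, so division with remainder
  -- forces equal rows and equal offsets, and then equal `y`-starts.
  slotted-unique : ∀ s t → 0 < col s → 0 < col t → Share (slotted s) (slotted t) → s ≡ t
  slotted-unique s t 0<s 0<t (i , j , i<m , j<m , ex , ey)
    with rows , refl ← quotient-unique (row s) (row t) i<m j<m ex
    = cong₂ _,_ (toℕ-injective rows)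
        (toℕ-injective (pred-cancel 0<s 0<t (+-cancelʳ-≡ i _ _ ey)))
    where
    pred-cancel : ∀ {a b} → 0 < a → 0 < b → pred a ≡ pred b → a ≡ b
    pred-cancel (s≤s _) (s≤s _) = cong suc

  Side : Slot → Set
  Side s = row s ℕ.* m < col s ⊎ 1 + row (opp s) ℕ.* m < col (opp s)

  side : ∀ s → Side s
  side s with ≤-<-connex (col s) (row s ℕ.* m)
  ... | inj₁ below = inj₂ (¬above⇒opp-above s below)
  ... | inj₂ above = inj₁ above

  decode : (s : Slot) → Side s → Diagonal l n
  decode s (inj₁ _) = slotted s
  decode s (inj₂ _) = flip (slotted (opp s))

  decode-unique : ∀ s t side side′ → Share (decode s side) (decode t side′) → s ≡ t
  decode-unique s t (inj₁ s↑) (inj₁ t↑) =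
    slotted-unique s t (m<n⇒0<n s↑) (m<n⇒0<n t↑)
  decode-unique s t (inj₂ s↓) (inj₂ t↓) =
    opp-injective ∘ slotted-unique (opp s) (opp t) (m<n⇒0<n s↓) (m<n⇒0<n t↓)
      ∘ share-flip (slotted (opp s)) (slotted (opp t))
  -- A shared point would carry `x ≤ y` over to a flipped diagonal, where `y < x`.
  decode-unique s t (inj₁ s↑) (inj₂ t↓) share = contradiction
    (share-≤ (slotted s) (flip (slotted (opp t))) share (<⇒≤pred s↑))
    (<⇒≱ (<⇒≤pred t↓))
  decode-unique s t s↓@(inj₂ _) t↑@(inj₁ _) =
    sym ∘ decode-unique t s t↑ s↓ ∘ share-sym (decode s s↓) (decode t t↑)

  D : ℕ
  D = suc p ℕ.* (3 + p ℕ.* m)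

  slotAt : Fin D → Slot
  slotAt = remQuot (3 + p ℕ.* m)

  slotAt-injective : ∀ {i j} → slotAt i ≡ slotAt j → i ≡ j
  slotAt-injective {i} {j} eq =
    trans (sym (combine-remQuot {suc p} _ i))
      (trans (cong (uncurry combine) eq) (combine-remQuot {suc p} _ j))

  place : Fin D → Diagonal l n
  place i = decode (slotAt i) (side (slotAt i))

  placement : Placeable l n D
  placement = place , λ i j i≢j meet → i≢j (slotAt-injective
    (decode-unique (slotAt i) (slotAt j) (side (slotAt i)) (side (slotAt j))
      (intersect⇒share (place i) (place j) meet)))

  placeable≤D : ∀ c → Placeable l n c → c ≤ D
  -- Pigeonhole: distinct indices get distinct codes, since equal codes would make the diagonals
  -- intersect.
  placeable≤D c (d , disjoint) = injective⇒≤ {f = uncurry combine ∘ code ∘ d} injective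
    where
    injective : ∀ {i j} → uncurry combine (code (d i)) ≡ uncurry combine (code (d j)) → i ≡ j
    injective {i} {j} eq with i Fin.≟ j
    ... | yes i≡j = i≡j
    ... | no  i≢j = contradiction
      (share⇒intersect (d i) (d j)
        (encode-share (d i) (d j) (orient (d i)) (orient (d j))
          (uncurry (cong₂ _,_) (combine-injective _ _ _ _ eq))))
      (disjoint i j i≢j)

  isD : IsD l n D
  isD = placement , placeable≤D

  -- The closed formula.

  D-formula : (+ D) / 1 ≡ ((+ n) ^ 2 - (+ n) * ((+ l) - (+ 2))) / m
  -- `mkℚᵘ` stores the denominator minus one, so 0 and `l` stand for 1 and `m`; cross-multiplying
  -- leaves an identity of integers.
  D-formula = fromℚᵘ-cong {mkℚᵘ (+ D) 0} {mkℚᵘ ((+ n) ^ 2 - (+ n) * ((+ l) - (+ 2))) l} (*≡* (begin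
    + D * + m                                         ≡⟨ cong (_* + m) D-cast ⟩
    + suc p * (+ 3 ℤ.+ + p * + m) * + m               ≡⟨ identity (+ p) (+ l) ⟩
    (n′ ^ 2 - n′ * (+ l - + 2)) * + 1
      ≡⟨ cong (λ z → (z ^ 2 - z * (+ l - + 2)) * + 1) (ℤ.pos-* (suc p) m) ⟨
    ((+ n) ^ 2 - (+ n) * (+ l - + 2)) * + 1           ∎))
    where
    open ≡-Reasoning

    n′ = + suc p * + m

    D-cast : + D ≡ + suc p * (+ 3 ℤ.+ + p * + m)
    D-cast = trans (ℤ.pos-* (suc p) _) (cong (λ z → + suc p * (+ 3 ℤ.+ z)) (ℤ.pos-* p m))

    -- The ring solver does not unfold _-_ and _^_ on ℤ.
    identity : ∀ p l → let n = (+ 1 ℤ.+ p) * (+ 1 ℤ.+ l) in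
      (+ 1 ℤ.+ p) * (+ 3 ℤ.+ p * (+ 1 ℤ.+ l)) * (+ 1 ℤ.+ l)
        ≡ (n * (n * + 1) ℤ.+ ℤ.- (n * (l ℤ.+ ℤ.- + 2))) * + 1
    identity = solve-∀

mainTheorem1 : (l n : ℕ) → .{{_ : NonZero l}} → .{{_ : NonZero n}} → suc l ∣ n →
    ∃ λ D → IsD l n D × (+ D) / 1 ≡ ((+ n) ^ 2 - (+ n) * ((+ l) - (+ 2))) / suc l
mainTheorem1 zero _ _ = contradiction refl (≢-nonZero⁻¹ 0)
mainTheorem1 (suc _) _ (divides zero refl) = contradiction refl (≢-nonZero⁻¹ 0)
mainTheorem1 (suc k) _ (divides (suc p) refl) = D , isD , D-formula
  where open Packing k p
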